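{- Let $G$ be a finite simple graph that is Z-insensitive. Then $\gamma_{Zg}(G)=\gamma_g(G)$ and $\gamma_{Zg}'(G)=\gamma_g'(G)$.
   Context: Graphs are finite and simple. $N(v)$ and $N[v]=N(v)\cup\{v\}$ denote the open and closed neighborhood of a vertex $v$, and $N[D]=\bigcup_{v\in D}N[v]$ for $D\subseteq V(G)$. Z-insensitive graphs: for $A\subseteq V(G)$, let $G|A$ denote the partially dominated graph in which the vertices of $A$ are considered already dominated. $G|A$ has a Z-configuration if there is a vertex $v\in V(G)\setminus A$ such that $N(v)\subseteq A$ and $|N(u)\setminus A|\ge 2$ for each $u\in N(v)$. A graph $G$ without isolated vertices is Z-insensitive if for every $D\subseteq V(G)$ the partially dominated graph $G|N[D]$ has no Z-configuration. Games: two players, Dominator and Staller, alternately select vertices $v_1,v_2,\ldots$ of an isolate-free graph $G$. In the domination game the $i$-th move $v_i$ is legal if $N[v_i]\setminus\bigcup_{j=1}^{i-1}N[v_j]\neq\emptyset$. In the Z-domination game the $i$-th move $v_i$ is legal if $N(v_i)\setminus\bigcup_{j=1}^{i-1}N[v_j]\neq\emptyset$. Each game ends when no legal move is available. Dominator wants to minimize the total number of moves, Staller wants to maximize it. When both players play optimally, the total number of moves played (by both players) is, in the domination game, $\gamma_g(G)$ if Dominator moves first and $\gamma_g'(G)$ if Staller moves first; and in the Z-domination game, $\gamma_{Zg}(G)$ if Dominator moves first and $\gamma_{Zg}'(G)$ if Staller moves first. -}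

module Defs where

open import Data.Fin.Base using (Fin)
open import Data.Fin.Subset
open import Data.Fin.Subset.Properties
open import Data.List.Base using (List; []; _∷_; map; filter; allFin)
open import Data.List.Extrema.Nat using (max; min)
open import Data.List.Properties using (map-cong-local)
open import Data.List.Relation.Unary.All using ([]; _∷_)
import Data.List.Relation.Unary.All as All
open import Data.List.Relation.Unary.All.Properties using (all-filter)
open import Data.Nat.Base using (ℕ; zero; suc; _≤_; _<_)
open import Data.Nat.Properties using (≤-trans; ≤-pred; n≤1+n; n≮0)
open import Data.Product.Base using (∃; _×_; _,_)
open import Data.Vec.Base using ([]; _∷_; here; there; tabulate)
open import Level using (0ℓ)
open import Relation.Binary.Core using (Rel)
open import Relation.Binary.Definitions using (Decidable; Irreflexive; Symmetric)
open import Relation.Binary.PropositionalEquality using (_≡_; refl; cong)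
open import Relation.Nullary using (¬_; Dec; does; contradiction)

record Graph (n : ℕ) : Set₁ where
  field
    Adj    : Rel (Fin n) 0ℓ
    adj?   : Decidable Adj
    sym    : Symmetric Adj
    irrefl : Irreflexive _≡_ Adj

data Player : Set where
  dominator staller : Player

opponent : Player → Player
opponent dominator = staller
opponent staller   = dominator

data Game : Set where
  domination Z-domination : Game

-- The total number of remaining moves for the player to move, given the
-- numbers of moves that would remain after each of the legal moves.
optimum : Player → List ℕ → ℕ
optimum _         []       = 0
optimum dominator (x ∷ xs) = suc (min x xs)
optimum staller   (x ∷ xs) = suc (max x xs)

p─q⊆∁q : ∀ {n} (p q : Subset n) → p ─ q ⊆ ∁ q
p─q⊆∁q (_ ∷ p) (outside ∷ q) here       = here
p─q⊆∁q (_ ∷ p) (outside ∷ q) (there x∈) = there (p─q⊆∁q p q x∈)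
p─q⊆∁q (_ ∷ p) (inside  ∷ q) (there x∈) = there (p─q⊆∁q p q x∈)

module _ {n : ℕ} (G : Graph n) where
  open Graph G

  N : Fin n → Subset n
  N v = tabulate λ u → does (adj? v u)

  N[_] : Fin n → Subset n
  N[ v ] = ⁅ v ⁆ ∪ N v

  dominated : List (Fin n) → Subset n
  dominated vs = ⋃ (map N[_] vs)

  -- N[D] for a set D of vertices.
  closedNeighborhood : Subset n → Subset n
  closedNeighborhood D = dominated (filter (_∈? D) (allFin n))

  IsolateFree : Set
  IsolateFree = ∀ v → ∃ λ u → Adj v u

  -- G|A is represented by G together with the set A.
  HasZConfiguration : Subset n → Set
  HasZConfiguration A =
    ∃ λ v → v ∉ A × N v ⊆ A × (∀ {u} → u ∈ N v → 2 ≤ ∣ N u ─ A ∣)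

  ZInsensitive : Set
  ZInsensitive =
    IsolateFree × (∀ D → ¬ HasZConfiguration (closedNeighborhood D))

  -- The vertices of which a move v must newly dominate at least one.
  target : Game → Fin n → Subset n
  target domination   v = N[ v ]
  target Z-domination v = N v

  -- The list h contains the moves made so far, the latest one first.
  Legal : Game → List (Fin n) → Fin n → Set
  Legal g h v = Nonempty (target g v ─ dominated h)

  legal? : ∀ g h v → Dec (Legal g h v)
  legal? g h v = nonempty? (target g v ─ dominated h)

  legalMoves : Game → List (Fin n) → List (Fin n)
  legalMoves g h = filter (legal? g h) (allFin n)

  -- The number of further moves under optimal play, p being the player to
  -- move, if the game is cut off after k further moves.
  boundedValue : ℕ → Game → Player → List (Fin n) → ℕ
  boundedValue zero    g p h = 0
  boundedValue (suc k) g p h =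
    optimum p (map (λ v → boundedValue k g (opponent p) (v ∷ h)) (legalMoves g h))

  -- Every legal move dominates a new vertex, so no game lasts longer than n
  -- moves and the bound n has no effect; value-unfold confirms that value
  -- satisfies the unbounded minimax recursion.
  value : Game → Player → List (Fin n) → ℕ
  value = boundedValue n

  γg γg′ γZg γZg′ : ℕ
  γg   = value domination   dominator []
  γg′  = value domination   staller   []
  γZg  = value Z-domination dominator []
  γZg′ = value Z-domination staller   []

  undominated : List (Fin n) → ℕ
  undominated h = ∣ ∁ (dominated h) ∣

  target⊆N[] : ∀ g v → target g v ⊆ N[ v ]
  target⊆N[] domination   v x∈ = x∈
  target⊆N[] Z-domination v x∈ = q⊆p∪q ⁅ v ⁆ (N v) x∈

  legal⇒undominated-< : ∀ g h {v} → Legal g h v → undominated (v ∷ h) < undominated h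
  legal⇒undominated-< g h {v} (x , x∈) = p⊂q⇒∣p∣<∣q∣ (sub , x , p─q⊆∁q (target g v) (dominated h) x∈ , out)
    where
    sub : ∁ (dominated (v ∷ h)) ⊆ ∁ (dominated h)
    sub y∈ = x∉p⇒x∈∁p λ y∈h → x∈∁p⇒x∉p y∈ (q⊆p∪q N[ v ] (dominated h) y∈h)

    out : x ∉ ∁ (dominated (v ∷ h))
    out x∈′ = x∈∁p⇒x∉p x∈′
      (p⊆p∪q (dominated h) (target⊆N[] g v (p─q⊆p (target g v) (dominated h) x∈)))

  boundedValue-stable : ∀ k l g p h → undominated h ≤ k → undominated h ≤ l →
                        boundedValue k g p h ≡ boundedValue l g p h
  boundedValue-stable zero    zero    g p h a b = refl
  boundedValue-stable zero    (suc l) g p h a b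
    with legalMoves g h | all-filter (legal? g h) (allFin n)
  ... | []     | _     = refl
  ... | v ∷ vs | q ∷ _ = contradiction (≤-trans (legal⇒undominated-< g h q) a) n≮0
  boundedValue-stable (suc k) zero    g p h a b
    with legalMoves g h | all-filter (legal? g h) (allFin n)
  ... | []     | _     = refl
  ... | v ∷ vs | q ∷ _ = contradiction (≤-trans (legal⇒undominated-< g h q) b) n≮0
  boundedValue-stable (suc k) (suc l) g p h a b =
    cong (optimum p) (map-cong-local (All.map step (all-filter (legal? g h) (allFin n))))
    where
    step : ∀ {v} → Legal g h v →
           boundedValue k g (opponent p) (v ∷ h) ≡ boundedValue l g (opponent p) (v ∷ h)
    step {v} q = boundedValue-stable k l g (opponent p) (v ∷ h)
      (≤-pred (≤-trans (legal⇒undominated-< g h q) a))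
      (≤-pred (≤-trans (legal⇒undominated-< g h q) b))

  value-unfold : ∀ g p h →
    value g p h ≡ optimum p (map (λ v → value g (opponent p) (v ∷ h)) (legalMoves g h))
  value-unfold g p h = boundedValue-stable n (suc n) g p h
    (∣p∣≤n (∁ (dominated h))) (≤-trans (∣p∣≤n (∁ (dominated h))) (n≤1+n n))

{-# OPTIONS --safe #-}

-- The two games differ only in moves v with v undominated and N(v) dominated.
-- In a Z-insensitive graph such a v has a neighbour u whose only undominated
-- neighbour is v, and u is a legal move of both games leading to the same
-- dominated set as v. So the legal moves of both games produce the same sets of
-- dominated vertices, and these sets determine the values of the games.
module Submission where

open import Defs
open import Data.Fin.Base using (Fin)
open import Data.Fin.Properties using (any?; _≟_)
open import Data.Fin.Subset using (Subset; _∈_; _∉_; _⊆_; _∪_; _─_; ⋃; ⁅_⁆; ∣_∣)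
open import Data.Fin.Subset.Properties
open import Data.List.Base using (List; []; _∷_; map; allFin)
open import Data.List.Extrema.Nat
  using (max; min; argmin-sel; argmax-sel; min≤⊤; min≤xs; ⊥≤max; xs≤max)
import Data.List.Membership.Propositional as List
open import Data.List.Membership.Propositional.Properties
  using (∈-map⁺; ∈-map∘filter⁺; ∈-map∘filter⁻; ∈-filter⁺; ∈-filter⁻; ∈-allFin)
import Data.List.Relation.Binary.Subset.Propositional as List
open import Data.List.Relation.Binary.Subset.Propositional.Properties using (map⁺)
import Data.List.Relation.Unary.All as All
open import Data.List.Relation.Unary.Any using (here; there)
open import Data.Nat.Base using (ℕ; zero; suc; _≤_)
open import Data.Nat.Properties using (≤-antisym; _≤?_)
open import Data.Product.Base using (∃; _×_; _,_; proj₁; proj₂)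
open import Data.Sum.Base using (inj₁; inj₂; [_,_]′)
open import Data.Vec.Properties using (lookup∘tabulate; []=⇒lookup; lookup⇒[]=)
open import Function.Base using (id; _∘_)
open import Relation.Binary.PropositionalEquality using (_≡_; _≢_; refl; sym; trans; cong; subst)
open import Relation.Nullary using (¬_; yes; no; ¬?; does; contradiction)
open import Relation.Nullary.Decidable using (_×-dec_; dec-true; decidable-stable)

private
  variable
    n : ℕ

min≤-∈ : ∀ {x xs y} → y List.∈ x ∷ xs → min x xs ≤ y
min≤-∈ {x} {xs} (here refl) = min≤⊤ x xs
min≤-∈ {x} {xs} (there y∈)  = All.lookup (min≤xs x xs) y∈

∈-≤max : ∀ {x xs y} → y List.∈ x ∷ xs → y ≤ max x xs
∈-≤max {x} {xs} (here refl) = ⊥≤max x xs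
∈-≤max {x} {xs} (there y∈)  = All.lookup (xs≤max x xs) y∈

min-∈ : ∀ x xs → min x xs List.∈ x ∷ xs
min-∈ x xs = [ here , there ]′ (argmin-sel id x xs)

max-∈ : ∀ x xs → max x xs List.∈ x ∷ xs
max-∈ x xs = [ here , there ]′ (argmax-sel id x xs)

-- The minimum or maximum of each list is attained, hence occurs in the other list and is bounded by
-- the extremum there. Order and multiplicity are ignored because several moves of one game may
-- correspond to a single move of the other.
optimum-cong : ∀ p {xs ys} → xs List.⊆ ys → ys List.⊆ xs → optimum p xs ≡ optimum p ys
optimum-cong p         {[]}     {[]}     xs⊆ys ys⊆xs = refl
optimum-cong p         {[]}     {y ∷ ys} xs⊆ys ys⊆xs with () ← ys⊆xs (here refl)
optimum-cong p         {x ∷ xs} {[]}     xs⊆ys ys⊆xs with () ← xs⊆ys (here refl)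
optimum-cong dominator {x ∷ xs} {y ∷ ys} xs⊆ys ys⊆xs =
  cong suc (≤-antisym (min≤-∈ (ys⊆xs (min-∈ y ys))) (min≤-∈ (xs⊆ys (min-∈ x xs))))
optimum-cong staller   {x ∷ xs} {y ∷ ys} xs⊆ys ys⊆xs =
  cong suc (≤-antisym (∈-≤max (xs⊆ys (max-∈ x xs))) (∈-≤max (ys⊆xs (max-∈ y ys))))

∈-⋃⁺ : ∀ {x} {p : Subset n} {ps} → p List.∈ ps → x ∈ p → x ∈ ⋃ ps
∈-⋃⁺ {ps = p ∷ ps} (here refl) x∈p = p⊆p∪q (⋃ ps) x∈p
∈-⋃⁺ {ps = q ∷ ps} (there p∈)  x∈p = q⊆p∪q q (⋃ ps) (∈-⋃⁺ p∈ x∈p)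

∈-⋃⁻ : ∀ {x} (ps : List (Subset n)) → x ∈ ⋃ ps → ∃ λ p → p List.∈ ps × x ∈ p
∈-⋃⁻ []       x∈ = contradiction x∈ ∉⊥
∈-⋃⁻ (p ∷ ps) x∈ with x∈p∪q⁻ p (⋃ ps) x∈
... | inj₁ x∈p = p , here refl , x∈p
... | inj₂ x∈ps with q , q∈ , x∈q ← ∈-⋃⁻ ps x∈ps = q , there q∈ , x∈q

⋃-mono : {ps qs : List (Subset n)} → ps List.⊆ qs → ⋃ ps ⊆ ⋃ qs
⋃-mono {ps = ps} ps⊆qs x∈ with p , p∈ , x∈p ← ∈-⋃⁻ ps x∈ = ∈-⋃⁺ (ps⊆qs p∈) x∈p

-- Z-insensitivity quantifies over vertex sets, while a position of the game is a list of moves.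
fromList : List (Fin n) → Subset n
fromList vs = ⋃ (map ⁅_⁆ vs)

∈-fromList⁺ : ∀ {v : Fin n} {vs} → v List.∈ vs → v ∈ fromList vs
∈-fromList⁺ {v = v} v∈ = ∈-⋃⁺ (∈-map⁺ ⁅_⁆ v∈) (x∈⁅x⁆ v)

∈-fromList⁻ : ∀ {v : Fin n} vs → v ∈ fromList vs → v List.∈ vs
∈-fromList⁻ []       v∈ = contradiction v∈ ∉⊥
∈-fromList⁻ (w ∷ ws) v∈ with x∈p∪q⁻ ⁅ w ⁆ (fromList ws) v∈
... | inj₁ v∈w  = here (x∈⁅y⁆⇒x≡y w v∈w)
... | inj₂ v∈ws = there (∈-fromList⁻ ws v∈ws)

distinct⇒2≤∣p∣ : ∀ {p : Subset n} {x y} → x ∈ p → y ∈ p → y ≢ x → 2 ≤ ∣ p ∣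
distinct⇒2≤∣p∣ {p = p} {x} {y} x∈p y∈p y≢x = subst (λ k → suc k ≤ ∣ p ∣) (∣⁅x⁆∣≡1 x)
  (p⊂q⇒∣p∣<∣q∣
    ( (λ z∈ → subst (_∈ p) (sym (x∈⁅y⁆⇒x≡y x z∈)) x∈p)
    , y , y∈p , y≢x ∘ x∈⁅y⁆⇒x≡y x))

module _ (G : Graph n) where
  open Graph G using (Adj; adj?) renaming (sym to Adj-sym)

  ∈N⁺ : ∀ {v u} → Adj v u → u ∈ N G v
  ∈N⁺ {v} {u} vu = lookup⇒[]= u (N G v) (trans (lookup∘tabulate _ u) (dec-true (adj? v u) vu))

  ∈N⁻ : ∀ {v u} → u ∈ N G v → Adj v u
  ∈N⁻ {v} {u} u∈
    with adj? v u | trans (sym (lookup∘tabulate (λ w → does (adj? v w)) u)) ([]=⇒lookup u∈)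
  ... | yes vu | _  = vu
  ... | no _   | ()

  ∈N-sym : ∀ {v u} → u ∈ N G v → v ∈ N G u
  ∈N-sym = ∈N⁺ ∘ Adj-sym ∘ ∈N⁻

  dominated-mono : ∀ {vs ws} → vs List.⊆ ws → dominated G vs ⊆ dominated G ws
  dominated-mono vs⊆ws = ⋃-mono (map⁺ (N[_] G) vs⊆ws)

  -- The two unions run over lists with the same members. This makes Z-insensitivity applicable to
  -- every position of a game.
  closedNeighborhood-fromList : ∀ vs → closedNeighborhood G (fromList vs) ≡ dominated G vs
  closedNeighborhood-fromList vs = ⊆-antisym
    (dominated-mono (∈-fromList⁻ vs ∘ proj₂ ∘ ∈-filter⁻ (_∈? fromList vs) {xs = allFin n}))
    (dominated-mono {vs} λ {v} v∈ → ∈-filter⁺ (_∈? fromList vs) (∈-allFin v) (∈-fromList⁺ {vs = vs} v∈))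

  Z-legal⇒legal : ∀ {h v} → Legal G Z-domination h v → Legal G domination h v
  Z-legal⇒legal {h} {v} (x , x∈) = x , x∈p∧x∉q⇒x∈p─q
    (target⊆N[] G Z-domination v (p─q⊆p (N G v) (dominated G h) x∈))
    (x∈∁p⇒x∉p (p─q⊆∁q (N G v) (dominated G h) x∈))

  module _ {h v} (legal : Legal G domination h v) (¬Z-legal : ¬ Legal G Z-domination h v) where

    N⊆dominated : N G v ⊆ dominated G h
    N⊆dominated {y} y∈ = decidable-stable (y ∈? dominated G h) λ y∉ →
      ¬Z-legal (y , x∈p∧x∉q⇒x∈p─q y∈ y∉)

    -- The vertex newly dominated by `v` lies in `N[ v ]` but not in `N v`, all of which is
    -- dominated, so it is `v`.
    undominated-self : v ∉ dominated G h
    undominated-self =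
      [ (λ x∈v → subst (_∉ dominated G h) (x∈⁅y⁆⇒x≡y v x∈v) x∉)
      , (λ x∈N → contradiction (N⊆dominated x∈N) x∉)
      ]′ (x∈p∪q⁻ ⁅ v ⁆ (N G v) (p─q⊆p (N[_] G v) (dominated G h) (proj₂ legal)))
      where
      x∉ : proj₁ legal ∉ dominated G h
      x∉ = x∈∁p⇒x∉p (p─q⊆∁q (N[_] G v) (dominated G h) (proj₂ legal))

    -- A finite search decides whether such a `u` exists; if it fails, `v` is a Z-configuration for
    -- the vertices dominated by `h`.
    private-neighbour : ZInsensitive G → ∃ λ u → u ∈ N G v × ¬ 2 ≤ ∣ N G u ─ dominated G h ∣
    private-neighbour (_ , noZ)
      with any? (λ u → (u ∈? N G v) ×-dec ¬? (2 ≤? ∣ N G u ─ dominated G h ∣))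
    ... | yes found = found
    ... | no none   = contradiction {A = HasZConfiguration G (dominated G h)}
      ( v , undominated-self , N⊆dominated
      , λ {u} u∈ → decidable-stable (2 ≤? _) λ small → none (u , u∈ , small))
      (subst (¬_ ∘ HasZConfiguration G) (closedNeighborhood-fromList h) (noZ (fromList h)))

    -- Take `u` from `private-neighbour`. Its only undominated neighbour is `v`, and `u` itself is
    -- already dominated, so either move newly dominates exactly `v`.
    replacement : ZInsensitive G →
      ∃ λ u → Legal G Z-domination h u × dominated G (u ∷ h) ≡ dominated G (v ∷ h)
    replacement Z-ins with u , u∈Nv , small ← private-neighbour Z-ins =
      u , (v , v∈) , ⊆-antisym u⊆v v⊆u
      where
      A : Subset n
      A = dominated G h

      v∈ : v ∈ N G u ─ A
      v∈ = x∈p∧x∉q⇒x∈p─q (∈N-sym u∈Nv) undominated-self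

      u⊆v : N[_] G u ∪ A ⊆ N[_] G v ∪ A
      u⊆v {y} y∈ with y ∈? A | x∈p∪q⁻ (N[_] G u) A y∈
      ... | yes y∈A | _        = q⊆p∪q (N[_] G v) A y∈A
      ... | no y∉A  | inj₂ y∈A = contradiction y∈A y∉A
      ... | no y∉A  | inj₁ y∈N[u] with y ≟ v | x∈p∪q⁻ ⁅ u ⁆ (N G u) y∈N[u]
      ...   | yes refl | _ = p⊆p∪q A (p⊆p∪q (N G v) (x∈⁅x⁆ v))
      -- Here `y` is `u`, which is dominated as a neighbour of `v`.
      ...   | no _     | inj₁ y∈u =
        contradiction (N⊆dominated (subst (_∈ N G v) (sym (x∈⁅y⁆⇒x≡y u y∈u)) u∈Nv)) y∉A
      -- Besides `v`, `y` would be a second undominated neighbour of `u`.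
      ...   | no y≢v   | inj₂ y∈N =
        contradiction (distinct⇒2≤∣p∣ v∈ (x∈p∧x∉q⇒x∈p─q y∈N y∉A) y≢v) small

      v⊆u : N[_] G v ∪ A ⊆ N[_] G u ∪ A
      v⊆u y∈ with x∈p∪q⁻ (N[_] G v) A y∈
      ... | inj₂ y∈A = q⊆p∪q (N[_] G u) A y∈A
      ... | inj₁ y∈N[v] with x∈p∪q⁻ ⁅ v ⁆ (N G v) y∈N[v]
      ...   | inj₁ y∈v = p⊆p∪q A (q⊆p∪q ⁅ u ⁆ (N G u)
                           (subst (_∈ N G u) (sym (x∈⁅y⁆⇒x≡y v y∈v)) (∈N-sym u∈Nv)))
      ...   | inj₂ y∈N = q⊆p∪q (N[_] G u) A (N⊆dominated y∈N)

  module _ (Z-ins : ZInsensitive G) where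

    -- Induction on `k`. The histories may differ, since replacing a move changes the history but
    -- not the dominated set, on which legality and all later play depend.
    boundedValue-≡ : ∀ k p {h h′} → dominated G h ≡ dominated G h′ →
                     boundedValue G k Z-domination p h ≡ boundedValue G k domination p h′
    boundedValue-≡ zero    p eq = refl
    boundedValue-≡ (suc k) p {h} {h′} eq = optimum-cong p Z⊆dom dom⊆Z
      where
      after : Game → List (Fin n) → Fin n → ℕ
      after g h v = boundedValue G k g (opponent p) (v ∷ h)

      Z⊆dom : map (after Z-domination h) (legalMoves G Z-domination h) List.⊆
              map (after domination h′) (legalMoves G domination h′)
      Z⊆dom x∈ with v , _ , refl , v-legal ←
        ∈-map∘filter⁻ (after Z-domination h) (legal? G Z-domination h) {xs = allFin n} x∈ =
        ∈-map∘filter⁺ (after domination h′) (legal? G domination h′)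
          ( v , ∈-allFin v
          , boundedValue-≡ k (opponent p) (cong (N[_] G v ∪_) eq)
          , subst (λ A → ∃ (_∈ N[_] G v ─ A)) eq (Z-legal⇒legal {h} v-legal))

      dom⊆Z : map (after domination h′) (legalMoves G domination h′) List.⊆
              map (after Z-domination h) (legalMoves G Z-domination h)
      dom⊆Z x∈ with v , _ , refl , v-legal′ ←
          ∈-map∘filter⁻ (after domination h′) (legal? G domination h′) {xs = allFin n} x∈
        with v-legal ← subst (λ A → ∃ (_∈ N[_] G v ─ A)) (sym eq) v-legal′
           | legal? G Z-domination h v
      ... | yes Z-legal = ∈-map∘filter⁺ (after Z-domination h) (legal? G Z-domination h)
        (v , ∈-allFin v , sym (boundedValue-≡ k (opponent p) (cong (N[_] G v ∪_) eq)) , Z-legal)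
      -- The Z-domination game answers `v` with `u`; the resulting histories start with different
      -- moves but dominate the same vertices.
      ... | no ¬Z-legal with u , u-legal , same ← replacement {h} v-legal ¬Z-legal Z-ins =
        ∈-map∘filter⁺ (after Z-domination h) (legal? G Z-domination h)
          ( u , ∈-allFin u
          , sym (boundedValue-≡ k (opponent p) (trans same (cong (N[_] G v ∪_) eq)))
          , u-legal)

theorem4p1 : ∀ {n : ℕ} (G : Graph n) → ZInsensitive G → (γZg G ≡ γg G) × (γZg′ G ≡ γg′ G)
theorem4p1 {n} G Z-ins = boundedValue-≡ G Z-ins n dominator refl , boundedValue-≡ G Z-ins n staller refl
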